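{- Let $D$ be an infinite, connected digraph which is primitive, distance-transitive, of finite out-valency, and has no directed cycles. If the out-valency of $D$ is $p^2$ for a prime $p$, then the descendant subdigraph of $D$ is a rooted tree; that is, for a vertex $\alpha$ of $D$, the underlying undirected graph of the subdigraph induced on $\mathrm{desc}(\alpha)$ is a tree.
   Context: A digraph $D$ has a vertex set and an edge set $E(D)\subseteq D\times D$ with no loops; subdigraphs are full induced subdigraphs. For an integer $s\ge 0$, an $s$-arc from $u$ to $v$ is a sequence $u_0u_1\dots u_s$ of vertices with $u_0=u$, $u_s=v$, $(u_i,u_{i+1})\in E(D)$ for $0\le i<s$, and $u_{i-1}\ne u_{i+1}$ for $0<i<s$. The descendant set $\mathrm{desc}(u)$ is the set of all vertices reachable from $u$ by an $s$-arc for some $s\ge0$; the descendant subdigraph of $\alpha$ is the subdigraph induced on $\mathrm{desc}(\alpha)$. $D$ is distance-transitive if for every $s\ge 0$, $\mathrm{Aut}(D)$ is transitive on the set of ordered pairs $(u,v)$ such that there is an $s$-arc from $u$ to $v$ but no $t$-arc from $u$ to $v$ for any $t<s$. $D$ is primitive if $\mathrm{Aut}(D)$ acts primitively on the vertex set. The out-valency of a vertex $\alpha$ is $|\{u:(\alpha,u)\in E(D)\}|$. A directed cycle is a sequence of vertices $u_0,u_1,\dots,u_n=u_0$ ($n\ge 1$) with $(u_i,u_{i+1})\in E(D)$ for all $i<n$. -}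

module Defs where

open import Data.Nat using (ℕ; zero; suc; _+_; _*_; _≤_; _<_)
open import Data.Fin using (Fin)
open import Data.Product using (Σ; ∃; _×_; _,_)
open import Data.Sum using (_⊎_)
open import Data.Empty using (⊥)
open import Data.Unit using (⊤)
open import Relation.Nullary using (¬_)
open import Relation.Binary.PropositionalEquality using (_≡_; _≢_)
open import Relation.Binary.Structures using (IsEquivalence)
open import Function.Bundles using (_↔_)

record Digraph : Set₁ where
  field
    V        : Set
    E        : V → V → Set
    loopless : ∀ v → ¬ E v v

module _ (D : Digraph) where
  open Digraph D

  record Arc (s : ℕ) (u v : V) : Set where
    field
      w      : ℕ → V
      start  : w 0 ≡ u
      end    : w s ≡ v
      edges  : ∀ i → i < s → E (w i) (w (suc i))
      noBack : ∀ i → suc (suc i) ≤ s → w i ≢ w (suc (suc i))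

  desc : V → V → Set
  desc u v = ∃ λ s → Arc s u v

  ArcDist : ℕ → V → V → Set
  ArcDist s u v = Arc s u v × (∀ t → t < s → ¬ Arc t u v)

  record Aut : Set where
    field
      to       : V → V
      from     : V → V
      to-from  : ∀ x → to (from x) ≡ x
      from-to  : ∀ x → from (to x) ≡ x
      pres     : ∀ x y → E x y → E (to x) (to y)
      refl'    : ∀ x y → E (to x) (to y) → E x y

  DistanceTransitive : Set
  DistanceTransitive =
    ∀ s u v u' v' → ArcDist s u v → ArcDist s u' v' →
      Σ Aut λ g → Aut.to g u ≡ u' × Aut.to g v ≡ v'

  Primitive : Set₁
  Primitive =
    (∀ u v → Σ Aut λ g → Aut.to g u ≡ v) ×
    (∀ (R : V → V → Set) → IsEquivalence R →
       (∀ (g : Aut) x y → R x y → R (Aut.to g x) (Aut.to g y)) →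
       (∀ x y → R x y → x ≡ y) ⊎ (∀ x y → R x y))

  Infinite : Set
  Infinite = ∀ n → ¬ (V ↔ Fin n)

  UEdge : V → V → Set
  UEdge x y = E x y ⊎ E y x

  record UWalkIn (P : V → Set) (u v : V) : Set where
    field
      len   : ℕ
      w     : ℕ → V
      start : w 0 ≡ u
      end   : w len ≡ v
      inP   : ∀ i → i ≤ len → P (w i)
      adj   : ∀ i → i < len → UEdge (w i) (w (suc i))

  record UCycleIn (P : V → Set) : Set where
    field
      n      : ℕ
      three  : 3 ≤ n
      w      : ℕ → V
      closed : w n ≡ w 0
      inP    : ∀ i → i < n → P (w i)
      adj    : ∀ i → i < n → UEdge (w i) (w (suc i))
      inj    : ∀ i j → i < n → j < n → w i ≡ w j → i ≡ j

  Connected : Set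
  Connected = ∀ u v → UWalkIn (λ _ → ⊤) u v

  OutValency : V → ℕ → Set
  OutValency α k =
    Σ (Fin k → V) λ nb →
      (∀ i j → nb i ≡ nb j → i ≡ j) ×
      (∀ i → E α (nb i)) ×
      (∀ u → E α u → ∃ λ i → nb i ≡ u)

  NoDirectedCycle : Set
  NoDirectedCycle =
    ∀ n (w : ℕ → V) → (∀ i → i < suc n → E (w i) (w (suc i))) → w (suc n) ≢ w 0

  IsTreeOn : (V → Set) → Set
  IsTreeOn P = (∀ u v → P u → P v → UWalkIn P u v) × ¬ UCycleIn P

{-# OPTIONS --safe #-}
-- Primitivity applied to the relation x ≡ y ⊎ P decides every P. Layers of a descendant set are
-- disjoint, and vertices with an equal n-th layer coincide, because primitivity makes the relation
-- "some n-th layers agree" trivial. Suppose two children of a vertex had a common descendant.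
-- The number of children of u above v, for v in the n-th layer of u, depends only on n and is
-- nondecreasing; its maximum d divides the number of n-walks from u to v, which is constant on the
-- layer and so divides (p²)ⁿ, whence p ∣ d. The transitive closure of "having a common descendant"
-- splits the children of u into classes of equal size c ∣ p². If c ≤ p, then c = d and the set of
-- children above a deep vertex is a whole class; if c = p², it is the same for all deep descendants
-- of a child, by induction from deep vertices upwards. Either way two distinct children have an
-- equal M-th layer, a contradiction.
module Submission where

open import Defs
open import Data.Nat using (ℕ; zero; suc; _+_; _*_; _^_; _∸_; _≤_; _<_; z≤n; s≤s; NonZero; >-nonZero; >-nonZero⁻¹)
open import Data.Nat.Properties
open import Data.Nat.Divisibility
open import Data.Nat.Coprimality using (Coprime; coprime-divisor)
open import Data.Nat.Primality
  using (Prime; prime⇒irreducible; euclidsLemma; prime⇒nonZero)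
open import Data.Nat.ListAction using (sum)
open import Data.Nat.ListAction.Properties using (sum-++; sum-↭)
open import Data.Nat.Induction using (<-rec)
open import Data.Fin using (Fin; toℕ; fromℕ<)
open import Data.Fin.Properties using (pigeonhole; toℕ<n; toℕ-fromℕ<)
open import Data.List using (List; []; _∷_; _++_; map; lookup; length; concatMap; tabulate; allFin)
open import Data.List.Properties using (map-++; length-++; length-tabulate; map-∘)
open import Data.List.Extrema ≤-totalOrder using (argmax; f[xs]≤f[argmax])
open import Data.List.Membership.Propositional using (_∈_; find; lose)
open import Data.List.Membership.Propositional.Properties
  using (∈-tabulate⁺; ∈-tabulate⁻; ∈-allFin; ∈-map⁺; ∈-map⁻; ∈-concatMap⁺; ∈-concatMap⁻)
open import Data.List.Membership.Propositional.Properties.WithK using (unique∧set⇒bag)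
open import Data.List.Relation.Unary.Any using (here; there; index)
open import Data.List.Relation.Unary.Any.Properties using (lookup-index)
import Data.List.Relation.Unary.All as All
open import Data.List.Relation.Unary.Unique.Propositional using (Unique)
import Data.List.Relation.Unary.Unique.Propositional.Properties as Unique
open import Data.List.Relation.Binary.Permutation.Propositional using (_↭_)
import Data.List.Relation.Binary.Permutation.Propositional.Properties as Perm
open import Data.List.Relation.Binary.BagAndSetEquality using (∼bag⇒↭)
open import Data.Product using (Σ; ∃; ∃₂; _×_; _,_; proj₁; proj₂)
open import Data.Sum using (_⊎_; inj₁; inj₂; swap; [_,_]′)
open import Data.Empty using (⊥; ⊥-elim)
open import Data.Unit using (⊤; tt)
open import Function using (_∘_; id)
open import Function.Bundles using (mk⇔)
open import Relation.Binary.Definitions using (tri<; tri≈; tri>)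
open import Relation.Binary.Structures using (IsEquivalence)
open import Relation.Binary.Construct.Closure.ReflexiveTransitive
  using (Star; ε; _◅_; _◅◅_; gmap; reverse)
open import Relation.Nullary using (¬_; Dec; yes; no; contradiction)
open import Relation.Binary.PropositionalEquality
  using (_≡_; _≢_; refl; sym; trans; cong; cong₂; subst; subst₂; isEquivalence; module ≡-Reasoning)

private variable
  A B : Set

-- Divisors of `p * p` and of powers of `p`

-- By Euclid's lemma `p` divides the cofactor `e` or `c`. In the first case `c` divides `p`; in the
-- second `c` is `c′ * p` with `c′` a divisor of `p`.
∣p*p⇒≤p⊎≡p*p : ∀ {p c} → Prime p → c ∣ p * p → c ≤ p ⊎ c ≡ p * p
∣p*p⇒≤p⊎≡p*p {p} {c} pr (divides e p*p≡e*c)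
  with euclidsLemma e c pr (divides p (sym p*p≡e*c))
... | inj₁ (divides e′ refl) = inj₁ (∣⇒≤ (divides e′ (*-cancelˡ-≡ p (e′ * c) p
        (trans p*p≡e*c (trans (cong (_* c) (*-comm e′ p)) (*-assoc p e′ c))))))
  where instance _ = prime⇒nonZero pr
... | inj₂ (divides c′ refl)
  with prime⇒irreducible pr (divides e (*-cancelʳ-≡ p (e * c′) p
         (trans p*p≡e*c (sym (*-assoc e c′ p)))))
  where instance _ = prime⇒nonZero pr
...   | inj₁ refl = inj₁ (≤-reflexive (+-identityʳ p))
...   | inj₂ refl = inj₂ refl

-- If `p` does not divide `d`, the two are coprime and one factor `p` can be cancelled.
∣p^k⇒≡1⊎p∣ : ∀ {p d} k → Prime p → d ∣ p ^ k → d ≡ 1 ⊎ p ∣ d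
∣p^k⇒≡1⊎p∣ zero _ d∣1 = inj₁ (∣1⇒≡1 d∣1)
∣p^k⇒≡1⊎p∣ {p} {d} (suc k) pr d∣p^ with p ∣? d
... | yes p∣d = inj₂ p∣d
... | no p∤d = ∣p^k⇒≡1⊎p∣ k pr (coprime-divisor coprime d∣p^)
  where
  coprime : Coprime d p
  coprime (e∣d , e∣p) with prime⇒irreducible pr e∣p
  ... | inj₁ e≡1  = e≡1
  ... | inj₂ refl = contradiction e∣d p∤d

∣[p*p]^k⇒≡1⊎p∣ : ∀ {p d} k → Prime p → d ∣ (p * p) ^ k → d ≡ 1 ⊎ p ∣ d
∣[p*p]^k⇒≡1⊎p∣ {p} {d} k pr d∣ = ∣p^k⇒≡1⊎p∣ (2 * k) pr (subst (d ∣_)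
  (trans (cong (λ m → (p * m) ^ k) (sym (*-identityʳ p))) (^-*-assoc p 2 k)) d∣)

-- Sums over lists

sum-map-mono : ∀ {f g : A → ℕ} xs → (∀ {x} → x ∈ xs → f x ≤ g x) →
  sum (map f xs) ≤ sum (map g xs)
sum-map-mono []       f≤g = z≤n
sum-map-mono (x ∷ xs) f≤g = +-mono-≤ (f≤g (here refl)) (sum-map-mono xs (f≤g ∘ there))

sum-map-cong : ∀ {f g : A → ℕ} xs → (∀ {x} → x ∈ xs → f x ≡ g x) →
  sum (map f xs) ≡ sum (map g xs)
sum-map-cong xs f≡g = ≤-antisym (sum-map-mono xs (≤-reflexive ∘ f≡g))
                                (sum-map-mono xs (≤-reflexive ∘ sym ∘ f≡g))

sum-map-* : ∀ (f : A → ℕ) m xs → sum (map (λ x → f x * m) xs) ≡ sum (map f xs) * m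
sum-map-* f m []       = refl
sum-map-* f m (x ∷ xs) = trans (cong (f x * m +_) (sum-map-* f m xs))
                               (sym (*-distribʳ-+ m (f x) _))

sum-map-concatMap : ∀ (f : B → ℕ) (g : A → List B) xs →
  sum (map f (concatMap g xs)) ≡ sum (map (λ x → sum (map f (g x))) xs)
sum-map-concatMap f g []       = refl
sum-map-concatMap f g (x ∷ xs) = begin
  sum (map f (g x ++ concatMap g xs))                ≡⟨ cong sum (map-++ f (g x) _) ⟩
  sum (map f (g x) ++ map f (concatMap g xs))        ≡⟨ sum-++ (map f (g x)) _ ⟩
  sum (map f (g x)) + sum (map f (concatMap g xs))   ≡⟨ cong (_ +_) (sum-map-concatMap f g xs) ⟩
  _ ∎
  where open ≡-Reasoning

length-concatMap : ∀ (g : A → List B) {c} xs → (∀ x → length (g x) ≡ c) →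
  length (concatMap g xs) ≡ length xs * c
length-concatMap g []       eq = refl
length-concatMap g (x ∷ xs) eq =
  trans (length-++ (g x)) (cong₂ _+_ (eq x) (length-concatMap g xs eq))

-- Counting with arbitrary predicates under excluded middle

module Classical (lem : (P : Set) → Dec P) where

  χ : Set → ℕ
  χ P with lem P
  ... | yes _ = 1
  ... | no  _ = 0

  χ-yes : ∀ {P} → P → χ P ≡ 1
  χ-yes {P} p with lem P
  ... | yes _ = refl
  ... | no ¬p = contradiction p ¬p

  χ-no : ∀ {P} → ¬ P → χ P ≡ 0
  χ-no {P} ¬p with lem P
  ... | yes p = contradiction p ¬p
  ... | no _  = refl

  χ-mono : ∀ {P Q} → (P → Q) → χ P ≤ χ Q
  χ-mono {P} P⇒Q with lem P
  ... | yes p = ≤-reflexive (sym (χ-yes (P⇒Q p)))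
  ... | no _  = z≤n

  χ-split : ∀ {P Q} → (Q → P) → χ P ≡ χ Q + χ (P × ¬ Q)
  χ-split {P} {Q} Q⇒P with lem Q | lem P
  ... | yes q | yes p = cong suc (sym (χ-no λ (_ , ¬q) → ¬q q))
  ... | yes q | no ¬p = contradiction (Q⇒P q) ¬p
  ... | no ¬q | yes p = sym (χ-yes (p , ¬q))
  ... | no ¬q | no ¬p = sym (χ-no (¬p ∘ proj₁))

  count : (A → Set) → List A → ℕ
  count P xs = sum (map (χ ∘ P) xs)

  count-mono : ∀ {P Q : A → Set} xs → (∀ {x} → x ∈ xs → P x → Q x) → count P xs ≤ count Q xs
  count-mono xs P⇒Q = sum-map-mono xs (χ-mono ∘ P⇒Q)

  count-split : ∀ {P Q : A → Set} xs → (∀ {x} → x ∈ xs → Q x → P x) →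
    count P xs ≡ count Q xs + count (λ x → P x × ¬ Q x) xs
  count-split []       Q⇒P = refl
  count-split {P = P} {Q} (x ∷ xs) Q⇒P = begin
    χ (P x) + count P xs       ≡⟨ cong₂ _+_ (χ-split (Q⇒P (here refl))) (count-split xs (Q⇒P ∘ there)) ⟩
    (a + b) + (c + d)          ≡⟨ +-assoc a b (c + d) ⟩
    a + (b + (c + d))          ≡⟨ cong (a +_) (trans (sym (+-assoc b c d))
                                    (trans (cong (_+ d) (+-comm b c)) (+-assoc c b d))) ⟩
    a + (c + (b + d))          ≡⟨ +-assoc a c (b + d) ⟨
    (a + c) + (b + d)          ∎
    where
    open ≡-Reasoning
    a = χ (Q x)
    b = χ (P x × ¬ Q x)
    c = count Q xs
    d = count (λ y → P y × ¬ Q y) xs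

  count-none : ∀ {P : A → Set} xs → (∀ {x} → x ∈ xs → ¬ P x) → count P xs ≡ 0
  count-none []       ¬P = refl
  count-none (x ∷ xs) ¬P = cong₂ _+_ (χ-no (¬P (here refl))) (count-none xs (¬P ∘ there))

  count-⊤ : ∀ (xs : List A) → count (λ _ → ⊤) xs ≡ length xs
  count-⊤ []       = refl
  count-⊤ (x ∷ xs) = cong₂ _+_ (χ-yes tt) (count-⊤ xs)

  count≤length : ∀ (P : A → Set) xs → count P xs ≤ length xs
  count≤length P xs = ≤-trans (count-mono xs (λ _ _ → tt)) (≤-reflexive (count-⊤ xs))

  count-pos : ∀ {P : A → Set} {x} xs → x ∈ xs → P x → 1 ≤ count P xs
  count-pos (x ∷ xs) (here refl) Px = ≤-trans (≤-reflexive (sym (χ-yes Px))) (m≤m+n _ _)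
  count-pos (x ∷ xs) (there x∈)  Px = ≤-trans (count-pos xs x∈ Px) (m≤n+m _ _)

  -- An entry in `Q` but not in `P` would make the count of `Q` strictly larger. This turns
  -- comparisons of cardinalities into inclusions of sets of children.
  count-full : ∀ {P Q : A → Set} xs → (∀ {x} → x ∈ xs → P x → Q x) → count Q xs ≤ count P xs →
    ∀ {x} → x ∈ xs → Q x → P x
  count-full {P = P} {Q} xs P⇒Q Q≤P {x} x∈ Qx with lem (P x)
  ... | yes Px = Px
  ... | no ¬Px = contradiction Q≤P (<⇒≱ (begin-strict
      count P xs                                     <⟨ m<m+n _ (count-pos xs x∈ (Qx , ¬Px)) ⟩
      count P xs + count (λ y → Q y × ¬ P y) xs      ≡⟨ count-split xs P⇒Q ⟨
      count Q xs                                     ∎))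
    where open ≤-Reasoning

  -- Since `P` is a union of classes, removing the class of one member removes exactly `m` entries
  -- and leaves a union of classes. The bound `n` makes the recursion terminate.
  classes∣count : ∀ {R : A → A → Set} → IsEquivalence R → ∀ {m} xs →
    (∀ {x} → x ∈ xs → count (R x) xs ≡ m) →
    ∀ n (P : A → Set) → (∀ {x y} → R x y → P x → P y) → count P xs ≤ n → m ∣ count P xs
  classes∣count {R = R} eqv {m} xs size n P closed P≤n with lem (∃ λ x → x ∈ xs × P x)
  ... | no none = subst (m ∣_) (sym (count-none xs λ x∈ Px → none (_ , x∈ , Px))) (m ∣0)
  ... | yes (x , x∈ , Px) = step n P≤n
    where
    rest = λ y → P y × ¬ R x y
    split : count P xs ≡ m + count rest xs
    split = trans (count-split xs λ _ Rxy → closed Rxy Px) (cong (_+ _) (size x∈))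
    1≤m : 1 ≤ m
    1≤m = subst (1 ≤_) (size x∈) (count-pos xs x∈ (IsEquivalence.refl eqv))
    step : ∀ n → count P xs ≤ n → m ∣ count P xs
    step zero    P≤0 = contradiction (≤-trans (count-pos xs x∈ Px) P≤0) λ ()
    step (suc n) P≤n = subst (m ∣_) (sym split) (∣m∣n⇒∣m+n ∣-refl
      (classes∣count eqv xs size n rest
        (λ Ryz (Py , ¬Rxy) → closed Ryz Py , λ Rxz → ¬Rxy (IsEquivalence.trans eqv Rxz (IsEquivalence.sym eqv Ryz)))
        (≤-pred (≤-trans (+-monoˡ-≤ _ 1≤m) (≤-trans (≤-reflexive (sym split)) P≤n)))))

  equal-classes∣length : ∀ {R : A → A → Set} → IsEquivalence R → ∀ {m} xs →
    (∀ {x} → x ∈ xs → count (R x) xs ≡ m) → m ∣ length xs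
  equal-classes∣length eqv xs size = subst (_ ∣_) (count-⊤ xs)
    (classes∣count eqv xs size (length xs) (λ _ → ⊤) _ (≤-reflexive (count-⊤ xs)))

  -- Climb to a larger value while there is one; the invariant `b ≤ f a + k` allows at most `k`
  -- further climbs.
  bounded⇒max : (f : A → ℕ) (b : ℕ) → (∀ a → f a ≤ b) → A → ∃ λ a → ∀ a′ → f a′ ≤ f a
  bounded⇒max {A = A} f b f≤b a = go b a (m≤n+m b (f a))
    where
    go : ∀ k a → (b ≤ f a + k) → ∃ λ a → ∀ a′ → f a′ ≤ f a
    go zero a b≤ = a , λ a′ → ≤-trans (f≤b a′) (≤-trans b≤ (≤-reflexive (+-identityʳ _)))
    go (suc k) a b≤ with lem (∃ λ a′ → f a < f a′)
    ... | no none        = a , λ a′ → ≮⇒≥ λ lt → none (a′ , lt)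
    ... | yes (a′ , lt)  = go k a′ (≤-trans b≤ (≤-trans (≤-reflexive (+-suc (f a) k)) (+-monoˡ-≤ k lt)))

-- Directed and undirected walks

module Walks (D : Digraph) where
  open Digraph D

  infixr 5 _∺_
  data Walk : ℕ → V → V → Set where
    nil : ∀ {u} → Walk 0 u u
    _∺_ : ∀ {n u v w} → E u v → Walk n v w → Walk (suc n) u w

  Desc : V → V → Set
  Desc u v = ∃ λ n → Walk n u v

  infixr 5 _++ʷ_
  _++ʷ_ : ∀ {m n u v w} → Walk m u v → Walk n v w → Walk (m + n) u w
  nil     ++ʷ r = r
  (e ∺ s) ++ʷ r = e ∺ (s ++ʷ r)

  Desc-trans : ∀ {u v w} → Desc u v → Desc v w → Desc u w
  Desc-trans (_ , r) (_ , s) = _ , r ++ʷ s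

  splitʷ : ∀ m {n u w} → Walk (m + n) u w → ∃ λ v → Walk m u v × Walk n v w
  splitʷ zero    r       = _ , nil , r
  splitʷ (suc m) (e ∺ r) with splitʷ m r
  ... | v , s , t = v , e ∺ s , t

  split≤ : ∀ {m n u w} → m ≤ n → Walk n u w → ∃ λ v → Walk m u v × Walk (n ∸ m) v w
  split≤ {m} m≤n r = splitʷ m (subst (λ k → Walk k _ _) (sym (m+[n∸m]≡n m≤n)) r)

  vertex : ∀ {n u v} → Walk n u v → ℕ → V
  vertex {u = u} nil     _       = u
  vertex {u = u} (e ∺ r) zero    = u
  vertex         (e ∺ r) (suc i) = vertex r i

  vertex-start : ∀ {n u v} (r : Walk n u v) → vertex r 0 ≡ u
  vertex-start nil     = refl
  vertex-start (e ∺ r) = refl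

  vertex-end : ∀ {n u v} (r : Walk n u v) → vertex r n ≡ v
  vertex-end nil     = refl
  vertex-end (e ∺ r) = vertex-end r

  vertex-edge : ∀ {n u v} (r : Walk n u v) i → i < n → E (vertex r i) (vertex r (suc i))
  vertex-edge (e ∺ r) zero    _         = subst (E _) (sym (vertex-start r)) e
  vertex-edge (e ∺ r) (suc i) (s≤s i<n) = vertex-edge r i i<n

  fromVertices : ∀ n (w : ℕ → V) → (∀ i → i < n → E (w i) (w (suc i))) → Walk n (w 0) (w n)
  fromVertices zero    w e = nil
  fromVertices (suc n) w e = e 0 (s≤s z≤n) ∺ fromVertices n (w ∘ suc) (λ i i<n → e (suc i) (s≤s i<n))

  arc⇒walk : ∀ {n u v} → Arc D n u v → Walk n u v
  arc⇒walk a = subst₂ (Walk _) start end (fromVertices _ w edges)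
    where open Arc a

  mapʷ : (g : Aut D) → ∀ {n u v} → Walk n u v → Walk n (Aut.to g u) (Aut.to g v)
  mapʷ g nil     = nil
  mapʷ g (e ∺ r) = Aut.pres g _ _ e ∺ mapʷ g r

  UStep : (V → Set) → V → V → Set
  UStep P x y = P x × P y × UEdge D x y

  ustep-sym : ∀ {P x y} → UStep P x y → UStep P y x
  ustep-sym (Px , Py , e) = Py , Px , swap e

  usteps⇒uwalk : ∀ {P u v} → P u → Star (UStep P) u v → UWalkIn D P u v
  usteps⇒uwalk {u = u} Pu ε = record
    { len = 0 ; w = λ _ → u ; start = refl ; end = refl ; inP = λ _ _ → Pu ; adj = λ _ () }
  usteps⇒uwalk {P} {u} Pu (_◅_ {j = x} (_ , Px , e) steps) = record
    { len = suc len ; w = w′ ; start = refl ; end = end ; inP = inP′ ; adj = adj′ }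
    where
    open UWalkIn (usteps⇒uwalk Px steps)
    w′ : ℕ → V
    w′ zero    = u
    w′ (suc i) = w i
    inP′ : ∀ i → i ≤ suc len → P (w′ i)
    inP′ zero    _         = Pu
    inP′ (suc i) (s≤s i≤) = inP i i≤
    adj′ : ∀ i → i < suc len → UEdge D (w′ i) (w′ (suc i))
    adj′ zero    _         = subst (UEdge D u) (sym start) e
    adj′ (suc i) (s≤s i<) = adj i i<

  -- If the relation is discrete, a proof of `P` would identify `u` and `v`; if it is total, the
  -- distinct `u` and `v` can only be related through `P`.
  primitive⇒lem : ∀ {u v} → u ≢ v → Primitive D → (P : Set) → Dec P
  primitive⇒lem {u} {v} u≢v (_ , prim) P
    with prim (λ x y → x ≡ y ⊎ P)
           (record { refl  = inj₁ refl
                   ; sym   = λ { (inj₁ x≡y) → inj₁ (sym x≡y) ; (inj₂ p) → inj₂ p }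
                   ; trans = λ { (inj₁ refl) y~z → y~z ; (inj₂ p) _ → inj₂ p } })
           (λ { g x y (inj₁ x≡y) → inj₁ (cong (Aut.to g) x≡y) ; g x y (inj₂ p) → inj₂ p })
  ... | inj₁ discrete = no λ p → u≢v (discrete u v (inj₂ p))
  ... | inj₂ total    = [ (λ u≡v → contradiction u≡v u≢v) , yes ]′ (total u v)

module Descendants
  (D : Digraph) (lem : (P : Set) → Dec P) (prim : Primitive D)
  (transitive : DistanceTransitive D) (acyclic : NoDirectedCycle D)
  {p : ℕ} (pr : Prime p) (valency : ∀ u → OutValency D u (p * p)) where

  open Digraph D
  open Walks D
  open Classical lem

  q : ℕ
  q = p * p

  instance
    p≢0 : NonZero p
    p≢0 = prime⇒nonZero pr

  -- Children of a vertex

  children : V → List V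
  children u = tabulate (proj₁ (valency u))

  children⇒E : ∀ {u z} → z ∈ children u → E u z
  children⇒E {u} z∈ with ∈-tabulate⁻ z∈
  ... | i , refl = proj₁ (proj₂ (proj₂ (valency u))) i

  E⇒children : ∀ {u z} → E u z → z ∈ children u
  E⇒children {u} e with proj₂ (proj₂ (proj₂ (valency u))) _ e
  ... | i , refl = ∈-tabulate⁺ i

  children-unique : ∀ u → Unique (children u)
  children-unique u = Unique.tabulate⁺ (proj₁ (proj₂ (valency u)) _ _)

  length-children : ∀ u → length (children u) ≡ q
  length-children u = length-tabulate (proj₁ (valency u))

  -- The enumerations in `valency` are unrelated at different vertices, so an automorphism respects
  -- them only up to order: both lists are duplicate-free with the same members.
  children-map : ∀ (g : Aut D) u → children (Aut.to g u) ↭ map (Aut.to g) (children u)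
  children-map g u = ∼bag⇒↭ (unique∧set⇒bag (children-unique (to u))
    (Unique.map⁺ to-injective (children-unique u)) (mk⇔ ⇒ ⇐))
    where
    open Aut g
    to-injective : ∀ {x y} → to x ≡ to y → x ≡ y
    to-injective eq = trans (sym (from-to _)) (trans (cong from eq) (from-to _))
    ⇒ : ∀ {z} → z ∈ children (to u) → z ∈ map to (children u)
    ⇒ {z} z∈ = subst (_∈ map to (children u)) (to-from z) (∈-map⁺ to (E⇒children
      (refl' u (from z) (subst (E (to u)) (sym (to-from z)) (children⇒E z∈)))))
    ⇐ : ∀ {z} → z ∈ map to (children u) → z ∈ children (to u)
    ⇐ z∈ with ∈-map⁻ to z∈
    ... | y , y∈ , refl = E⇒children (pres u y (children⇒E y∈))

  sum-children : ∀ (g : Aut D) (f : V → ℕ) u →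
    sum (map f (children (Aut.to g u))) ≡ sum (map (f ∘ Aut.to g) (children u))
  sum-children g f u = trans (sum-↭ (Perm.map⁺ f (children-map g u)))
                             (cong sum (sym (map-∘ (children u))))

  abstract
    child : V → V
    child u = proj₁ (valency u) (fromℕ< (>-nonZero⁻¹ q {{m*n≢0 p p}}))

    E-child : ∀ u → E u (child u)
    E-child u = proj₁ (proj₂ (proj₂ (valency u))) _

    extend : ∀ n u → ∃ (Walk n u)
    extend zero    u = u , nil
    extend (suc n) u with extend n (child u)
    ... | v , r = v , E-child u ∺ r

  -- Walks, arcs and layers

  no-closed-walk : ∀ {n u} → 0 < n → ¬ Walk n u u
  no-closed-walk (s≤s _) r = acyclic _ (vertex r) (vertex-edge r) (trans (vertex-end r) (sym (vertex-start r)))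

  -- Turning back would give a closed walk of length two.
  walk⇒arc : ∀ {n u v} → Walk n u v → Arc D n u v
  walk⇒arc r = record
    { w = vertex r ; start = vertex-start r ; end = vertex-end r ; edges = vertex-edge r
    ; noBack = λ i 2+i≤n eq → no-closed-walk (s≤s z≤n)
        (vertex-edge r i (≤-trans (n≤1+n _) 2+i≤n) ∺
         subst (E _) (sym eq) (vertex-edge r (suc i) 2+i≤n) ∺ nil) }

  -- layer n u lists the endpoints of all n-walks from u, one entry per walk.
  layer : ℕ → V → List V
  layer zero    u = u ∷ []
  layer (suc n) u = concatMap (layer n) (children u)

  length-layer : ∀ n u → length (layer n u) ≡ q ^ n
  length-layer zero    u = refl
  length-layer (suc n) u = trans (length-concatMap (layer n) (children u) (length-layer n))
                                 (cong (_* q ^ n) (length-children u))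

  walk⇒layer : ∀ {n u v} → Walk n u v → v ∈ layer n u
  walk⇒layer nil     = here refl
  walk⇒layer {suc n} (e ∺ r) = ∈-concatMap⁺ (layer n) (lose (E⇒children e) (walk⇒layer r))

  layer⇒walk : ∀ {n u v} → v ∈ layer n u → Walk n u v
  layer⇒walk {zero}  (here refl) = nil
  layer⇒walk {suc n} v∈ with find (∈-concatMap⁻ (layer n) v∈)
  ... | z , z∈ , v∈′ = children⇒E z∈ ∺ layer⇒walk v∈′

  abstract
    -- A t-walk parallel to an s-walk with s < t transfers to every vertex of the s-th layer, so each
    -- of these has a proper ancestor in the same layer; the layer being finite, this gives a cycle.
    walks-shortest : ∀ s {t u v} → s < t → Walk s u v → ¬ Walk t u v
    walks-shortest = <-rec _ step
      where
      step : ∀ s → (∀ {r} → r < s → ∀ {t u v} → r < t → Walk r u v → ¬ Walk t u v) →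
             ∀ {t u v} → s < t → Walk s u v → ¬ Walk t u v
      step s ih {t} {u} {v} s<t r r′ = cycle
        where
        -- The induction hypothesis rules out walks shorter than `s`, so `s` is the distance that
        -- distance-transitivity asks for.
        dist : ∀ {x} → Walk s u x → ArcDist D s u x
        dist a = walk⇒arc a , λ _ k<s b → ih k<s k<s (arc⇒walk b) a

        -- An automorphism fixing `u` and taking `v` to `x` carries the `t`-walk along; the image is
        -- cut after `s` edges.
        back : ∀ {x} → Walk s u x → ∃ λ y → Walk s u y × Walk (t ∸ s) y x
        back a with transitive s u v u _ (dist r) (dist a)
        ... | g , gu≡u , gv≡x = split≤ (<⇒≤ s<t) (subst₂ (Walk t) gu≡u gv≡x (mapʷ g r′))

        ancestor : ℕ → ∃ (Walk s u)
        ancestor zero    = v , r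
        ancestor (suc k) with back (proj₂ (ancestor k))
        ... | y , a , _ = y , a

        descend : ∀ k m → Walk (m * (t ∸ s)) (proj₁ (ancestor (m + k))) (proj₁ (ancestor k))
        descend k zero    = nil
        descend k (suc m) = proj₂ (proj₂ (back (proj₂ (ancestor (m + k))))) ++ʷ descend k m

        no-return : ∀ k m → 0 < m → proj₁ (ancestor (m + k)) ≢ proj₁ (ancestor k)
        no-return k (suc m) _ eq = no-closed-walk
          (≤-trans (m<n⇒0<n∸m s<t) (m≤m+n _ _)) (subst (Walk _ _) (sym eq) (descend k (suc m)))

        cycle : ⊥
        -- One more ancestor is taken than the layer has entries.
        cycle with pigeonhole (n<1+n (length (layer s u)))
                     (λ i → index (walk⇒layer (proj₂ (ancestor (toℕ i)))))
        ... | i , j , i<j , eq = no-return (toℕ i) (toℕ j ∸ toℕ i) (m<n⇒0<n∸m i<j) (begin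
            proj₁ (ancestor (toℕ j ∸ toℕ i + toℕ i))    ≡⟨ cong (proj₁ ∘ ancestor) (m∸n+n≡m (<⇒≤ i<j)) ⟩
            proj₁ (ancestor (toℕ j))                     ≡⟨ lookup-index (walk⇒layer (proj₂ (ancestor (toℕ j)))) ⟩
            _                                            ≡⟨ cong (lookup (layer s u)) eq ⟨
            _                                            ≡⟨ lookup-index (walk⇒layer (proj₂ (ancestor (toℕ i)))) ⟨
            proj₁ (ancestor (toℕ i))                     ∎)
          where open ≡-Reasoning

    layered : ∀ {m n u v} → Walk m u v → Walk n u v → m ≡ n
    layered {m} {n} r s with <-cmp m n
    ... | tri< m<n _ _ = contradiction s (walks-shortest m m<n r)
    ... | tri≈ _ m≡n _ = m≡n
    ... | tri> _ _ n<m = contradiction r (walks-shortest n n<m s)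

    -- Every walk realises the distance between its ends, so distance-transitivity applies to any
    -- two walks of equal length.
    move : ∀ {n u v u′ v′} → Walk n u v → Walk n u′ v′ →
      Σ (Aut D) λ g → Aut.to g u ≡ u′ × Aut.to g v ≡ v′
    move r s = transitive _ _ _ _ _ (dist r) (dist s)
      where
      dist : ∀ {n u v} → Walk n u v → ArcDist D n u v
      dist r = walk⇒arc r , λ k k<n a → walks-shortest k k<n (arc⇒walk a) r

  -- Moving either pair to the other gives both inequalities, so for an invariant it is enough to
  -- check that automorphisms do not decrease it.
  move-≡ : ∀ {n u v u′ v′} (f : V → V → ℕ) →
    (∀ (g : Aut D) u v → f u v ≤ f (Aut.to g u) (Aut.to g v)) →
    Walk n u v → Walk n u′ v′ → f u v ≡ f u′ v′
  move-≡ f f-mono r s = ≤-antisym (half r s) (half s r)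
    where
    half : ∀ {n u v u′ v′} → Walk n u v → Walk n u′ v′ → f u v ≤ f u′ v′
    half {u = u} {v} r s =
      let g , gu≡u′ , gv≡v′ = move r s
      in subst₂ (λ x y → f u v ≤ f x y) gu≡u′ gv≡v′ (f-mono g u v)

  -- Vertices with an equal layer

  inverse : Aut D → Aut D
  inverse g = record
    { to = from ; from = to ; to-from = from-to ; from-to = to-from
    ; pres  = λ x y e → refl' _ _ (subst₂ E (sym (to-from x)) (sym (to-from y)) e)
    ; refl' = λ x y e → subst₂ E (to-from x) (to-from y) (pres _ _ e) }
    where open Aut g

  layer⊆ : ℕ → V → V → Set
  layer⊆ n x y = ∀ {v} → Walk n x v → Walk n y v

  layer⊆-map : ∀ (g : Aut D) {n x y} → layer⊆ n x y → layer⊆ n (Aut.to g x) (Aut.to g y)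
  layer⊆-map g {x = x} sub {v} r = subst (Walk _ _) (to-from v)
    (mapʷ g (sub (subst (λ z → Walk _ z _) (from-to x) (mapʷ (inverse g) r))))
    where open Aut g

  layer⊆-+ : ∀ {m x y} n → layer⊆ m x y → layer⊆ (m + n) x y
  layer⊆-+ {m} n sub r with splitʷ m r
  ... | _ , r₁ , r₂ = sub r₁ ++ʷ r₂

  equal-layers⇒≡ : ∀ {n x y} → layer⊆ n x y → layer⊆ n y x → x ≡ y
  equal-layers⇒≡ {n} {x} {y} x⊆y y⊆x with proj₂ prim _~_ equivalence invariant
    where
    _~_ : V → V → Set
    x ~ y = ∃ λ n → layer⊆ n x y × layer⊆ n y x
    equivalence : IsEquivalence _~_
    equivalence = record
      { refl  = 0 , id , id
      ; sym   = λ (n , a , b) → n , b , a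
      -- Equal layers stay equal at greater depth, so both equalities are brought to depth `m + n`.
      ; trans = λ {x} {y} {z} (m , a , b) (n , c , d) → m + n ,
          layer⊆-+ n a ⨟ subst (λ k → layer⊆ k y z) (+-comm n m) (layer⊆-+ m c) ,
          subst (λ k → layer⊆ k z y) (+-comm n m) (layer⊆-+ m d) ⨟ layer⊆-+ n b }
      where
      _⨟_ : ∀ {n x y z} → layer⊆ n x y → layer⊆ n y z → layer⊆ n x z
      (f ⨟ g) r = g (f r)
    invariant : ∀ g x y → x ~ y → Aut.to g x ~ Aut.to g y
    invariant g x y (n , a , b) = n , layer⊆-map g a , layer⊆-map g b
  ... | inj₁ discrete = discrete x y (n , x⊆y , y⊆x)
  ... | inj₂ total with total x (child x)
  -- A vertex `m` steps below `child x` would also lie `m` steps below `x`, hence at two depths.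
  ...   | m , _ , c⊆x with extend m (child x)
  ...     | v , r = contradiction (layered (c⊆x r) (E-child x ∺ r)) (<⇒≢ (n<1+n m))

  -- Children above a descendant, and numbers of walks

  above : V → V → ℕ
  above u v = count (λ z → Desc z v) (children u)

  above-map : ∀ (g : Aut D) u v → above u v ≤ above (Aut.to g u) (Aut.to g v)
  above-map g u v = ≤-trans (count-mono (children u) λ _ (n , r) → n , mapʷ g r)
                            (≤-reflexive (sym (sum-children g _ u)))

  above-mono : ∀ {u v w} → Desc v w → above u v ≤ above u w
  above-mono {u} s = count-mono (children u) λ _ r → Desc-trans r s

  -- As `layer` repeats endpoints, this is the number of `n`-walks from `u` to `v`.
  paths : ℕ → V → V → ℕ
  paths n u v = count (v ≡_) (layer n u)

  paths-suc : ∀ n u v → paths (suc n) u v ≡ sum (map (λ z → paths n z v) (children u))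
  paths-suc n u v = sum-map-concatMap (χ ∘ (v ≡_)) (layer n) (children u)

  paths-map : ∀ n (g : Aut D) u v → paths n u v ≤ paths n (Aut.to g u) (Aut.to g v)
  paths-map zero    g u v = +-monoˡ-≤ 0 (χ-mono (cong (Aut.to g)))
  paths-map (suc n) g u v = begin
    paths (suc n) u v                                            ≡⟨ paths-suc n u v ⟩
    sum (map (λ z → paths n z v) (children u))                   ≤⟨ sum-map-mono (children u) (λ _ → paths-map n g _ v) ⟩
    sum (map (λ z → paths n (to z) (to v)) (children u))         ≡⟨ sum-children g _ u ⟨
    sum (map (λ z → paths n z (to v)) (children (to u)))         ≡⟨ paths-suc n (to u) (to v) ⟨
    paths (suc n) (to u) (to v)                                  ∎
    where
    open ≤-Reasoning
    open Aut g

  -- By transitivity every vertex of the layer is repeated equally often among the `q ^ n` entries.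
  paths∣q^n : ∀ {n u v} → Walk n u v → paths n u v ∣ q ^ n
  paths∣q^n {n} {u} {v} r = subst (paths n u v ∣_) (length-layer n u)
    (equal-classes∣length isEquivalence (layer n u)
      λ x∈ → move-≡ (paths n) (paths-map n) (layer⇒walk x∈) r)

  -- Sort the walks by their first step. A child that reaches `v` does so at depth `n`, with as many
  -- walks as `z`; any other child contributes none.
  paths-above : ∀ {n u z v} → E u z → Walk n z v → paths (suc n) u v ≡ above u v * paths n z v
  paths-above {n} {u} {z} {v} e r = begin
    paths (suc n) u v                                            ≡⟨ paths-suc n u v ⟩
    sum (map (λ x → paths n x v) (children u))                   ≡⟨ sum-map-cong (children u) uniform ⟩
    sum (map (λ x → χ (Desc x v) * paths n z v) (children u))    ≡⟨ sum-map-* _ (paths n z v) (children u) ⟩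
    above u v * paths n z v                                      ∎
    where
    open ≡-Reasoning
    uniform : ∀ {x} → x ∈ children u → paths n x v ≡ χ (Desc x v) * paths n z v
    uniform {x} x∈ with lem (Desc x v)
    ... | no ¬s = count-none (layer n x) λ { y∈ refl → ¬s (n , layer⇒walk y∈) }
    ... | yes (k , s) with layered (children⇒E x∈ ∺ s) (e ∺ r)
    ...   | refl = trans (move-≡ (paths n) (paths-map n) s r) (sym (*-identityˡ _))

  above∣q^n : ∀ {n u v} → Walk (suc n) u v → above u v ∣ q ^ suc n
  above∣q^n (e ∺ r) = ∣-trans (subst (above _ _ ∣_) (sym (paths-above e r)) (m∣m*n _)) (paths∣q^n (e ∺ r))

  -- Classes of linked children

  Linked : V → V → V → Set
  Linked u z z′ = E u z × E u z′ × ∃ λ v → Desc z v × Desc z′ v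

  _⊢_∼_ : V → V → V → Set
  u ⊢ z ∼ z′ = Star (Linked u) z z′

  ∼-isEquivalence : ∀ u → IsEquivalence (u ⊢_∼_)
  ∼-isEquivalence u = record
    { refl = ε ; sym = reverse (λ (e , e′ , v , r , r′) → e′ , e , v , r′ , r) ; trans = _◅◅_ }

  classSize : V → V → ℕ
  classSize u z = count (u ⊢ z ∼_) (children u)

  classSize-map : ∀ (g : Aut D) u z → classSize u z ≤ classSize (Aut.to g u) (Aut.to g z)
  classSize-map g u z = ≤-trans
    (count-mono (children u) λ _ → gmap (Aut.to g) λ (e , e′ , v , (_ , r) , (_ , r′)) →
      Aut.pres g _ _ e , Aut.pres g _ _ e′ , Aut.to g v , (_ , mapʷ g r) , (_ , mapʷ g r′))
    (≤-reflexive (sym (sum-children g _ u)))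

  classSize-const : ∀ {u z u′ z′} → E u z → E u′ z′ → classSize u z ≡ classSize u′ z′
  classSize-const e e′ = move-≡ classSize classSize-map (e ∺ nil) (e′ ∺ nil)

  -- Edges are walks of length 1, so automorphisms permute them transitively and all classes have
  -- the same size.
  classSize∣q : ∀ {u z} → E u z → classSize u z ∣ q
  classSize∣q {u} {z} e = subst (classSize u z ∣_) (length-children u)
    (equal-classes∣length (∼-isEquivalence u) (children u) λ x∈ → classSize-const (children⇒E x∈) e)

  -- Contradiction from two children with a common descendant

  module Collision {u₀ z₀ z₀′ v₀} (e₀ : E u₀ z₀) (e₀′ : E u₀ z₀′)
    (r₀ : Desc z₀ v₀) (r₀′ : Desc z₀′ v₀) (z₀≢z₀′ : z₀ ≢ z₀′) where

    abstract
      maximum : ∃ λ (a : ∃₂ λ u v → Desc u v) → ∀ (b : ∃₂ λ u v → Desc u v) →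
                above (proj₁ b) (proj₁ (proj₂ b)) ≤ above (proj₁ a) (proj₁ (proj₂ a))
      maximum = bounded⇒max (λ (u , v , _) → above u v) q
        (λ (u , v , _) → ≤-trans (count≤length _ (children u)) (≤-reflexive (length-children u)))
        (z₀ , v₀ , r₀)

    u* v* : V
    u* = proj₁ (proj₁ maximum)
    v* = proj₁ (proj₂ (proj₁ maximum))

    M d : ℕ
    M = proj₁ (proj₂ (proj₂ (proj₁ maximum)))
    d = above u* v*

    walk* : Walk M u* v*
    walk* = proj₂ (proj₂ (proj₂ (proj₁ maximum)))

    above≤d : ∀ {n u v} → Walk n u v → above u v ≤ d
    above≤d r = proj₂ maximum (_ , _ , _ , r)

    Deep : V → V → Set
    Deep u v = ∃ λ n → M ≤ n × Walk n u v

    deepen : ∀ {u v w} → Desc u v → Walk M v w → Deep u w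
    deepen (n , r) s = n + M , m≤n+m M n , r ++ʷ s

    -- At depth `M` the walk passes a vertex `x` for which `(u , x)` is an image of the maximising
    -- pair; below `x` the count cannot drop, and `d` is the maximum.
    above-deep : ∀ {u v} → Deep u v → above u v ≡ d
    above-deep {u} {v} (n , M≤n , r) with split≤ M≤n r
    ... | x , s , t = ≤-antisym (above≤d r) (begin
      d            ≡⟨ move-≡ above above-map walk* s ⟩
      above u x    ≤⟨ above-mono (_ , t) ⟩
      above u v    ∎)
      where open ≤-Reasoning

    -- The count at a deep vertex is already maximal, so no new child can appear above a vertex
    -- further down.
    above-stable : ∀ {u v w z} → Deep u v → Desc v w → E u z → Desc z w → Desc z v
    above-stable {u} deep@(n , _ , r) (m , s) e = count-full (children u)
      (λ _ a → Desc-trans a (m , s))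
      (≤-trans (above≤d (r ++ʷ s)) (≤-reflexive (sym (above-deep deep)))) (E⇒children e)

    -- Expresses that the set of children of `u` above a deep vertex is constant on the deep
    -- descendants of `y`. One inclusion suffices, as `v` and `v′` may be exchanged.
    Homogeneous : V → V → Set
    Homogeneous u y = ∀ {v v′ x} → Desc y v → Deep u v → Desc y v′ → Deep u v′ →
      E u x → Desc x v → Desc x v′

    -- Two children with a common descendant also have a deep one, `w`. Homogeneity transfers being
    -- above `w` to being above any vertex `M` steps below `z`, so the two `M`-th layers coincide.
    not-homogeneous : ¬ (∀ {u z} → E u z → Homogeneous u z)
    not-homogeneous hom = z₀≢z₀′
      (equal-layers⇒≡ (sub e₀ r₀ e₀′ r₀′) (sub e₀′ r₀′ e₀ r₀))
      where
      sub : ∀ {u z z′ v} → E u z → Desc z v → E u z′ → Desc z′ v → layer⊆ M z z′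
      sub {v = v} e r e′ r′ s with extend M v
      ... | w , t with hom e (Desc-trans r (_ , t)) (deepen (_ , e ∺ proj₂ r) t)
                         (_ , s) (_ , n≤1+n M , e ∺ s) e′ (Desc-trans r′ (_ , t))
      ...   | k , s′ with layered (e ∺ s) (e′ ∺ s′)
      ...     | refl = s′

    -- If at most one child of `u₀` lay above `v₀`, then `z₀` would fill the set and `z₀′` would
    -- equal it.
    1<d : 1 < d
    1<d = ≤-trans (≰⇒> λ above≤1 → z₀≢z₀′ (count-full {P = z₀ ≡_} (children u₀)
        (λ { _ refl → r₀ }) (≤-trans above≤1 (count-pos (children u₀) (E⇒children e₀) refl))
        (E⇒children e₀′) r₀′))
      (above≤d (e₀ ∺ proj₂ r₀))

    p≤d : p ≤ d
    -- Length `suc M` is deep and positive, so `d` divides a power of `q`; since it is not 1, `p`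
    -- divides it.
    p≤d = let _ , r = extend (suc M) u₀ in
      [ (λ d≡1 → contradiction (sym d≡1) (<⇒≢ 1<d)) , ∣⇒≤ {{>-nonZero (<⇒≤ 1<d)}} ]′
      (∣[p*p]^k⇒≡1⊎p∣ (suc M) pr (subst (_∣ q ^ suc M) (above-deep (_ , n≤1+n M , r)) (above∣q^n r)))

    -- With d ≤ |class| ≤ p ≤ d, the d children above a deep vertex fill a whole class.
    homogeneous-small : classSize u₀ z₀ ≤ p → ∀ {u z} → E u z → Homogeneous u z
    homogeneous-small c≤p {u} {z} e {v} {v′} z→v _ z→v′ deep′ ex x→v =
      count-full (children u) (λ y∈ y→v′ → (e , children⇒E y∈ , v′ , z→v′ , y→v′) ◅ ε)
        (begin
          classSize u z      ≡⟨ classSize-const e e₀ ⟩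
          classSize u₀ z₀    ≤⟨ c≤p ⟩
          p                  ≤⟨ p≤d ⟩
          d                  ≡⟨ above-deep deep′ ⟨
          above u v′         ∎)
        (E⇒children ex) ((e , ex , v , z→v , x→v) ◅ ε)
      where open ≤-Reasoning

    module _ (c≡q : classSize u₀ z₀ ≡ q) where

      all-linked : ∀ {u z z′} → E u z → E u z′ → u ⊢ z ∼ z′
      all-linked {u} {z} e e′ = count-full (children u) (λ _ _ → tt)
        (≤-reflexive (begin
          count (λ _ → ⊤) (children u)    ≡⟨ count-⊤ (children u) ⟩
          length (children u)             ≡⟨ length-children u ⟩
          q                               ≡⟨ c≡q ⟨
          classSize u₀ z₀                 ≡⟨ classSize-const e₀ e ⟩
          classSize u z                   ∎))
        (E⇒children e′) tt
        where open ≡-Reasoning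

      -- Homogeneity holds trivially at depth M and climbs towards u: linked children of y share
      -- deep descendants.
      homogeneous-walk : ∀ j {k u y} → Walk k u y → M ≤ j + k → Homogeneous u y
      homogeneous-walk zero r M≤k y→v _ y→v′ _ ex x→v =
        Desc-trans (above-stable (_ , M≤k , r) y→v ex x→v) y→v′
      -- If `v` or `v′` is `y` itself, no child of `y` is available; transitivity or stability
      -- settles these cases.
      homogeneous-walk (suc j) r M≤ (_ , nil) _ y→v′ _ _ x→v = Desc-trans x→v y→v′
      homogeneous-walk (suc j) r M≤ y→v@(_ , _ ∺ _) _ (_ , nil) deep′ ex x→v =
        above-stable deep′ y→v ex x→v
      homogeneous-walk (suc j) {k} {u} {y} r M≤ {v′ = v′} (_ , e ∺ s) deep (_ , e′ ∺ s′) deep′ ex =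
        along (all-linked e e′) e (_ , s) deep
        where
        hom : ∀ {z} → E y z → Homogeneous u z
        hom e = homogeneous-walk j (r ++ʷ (e ∺ nil))
          (≤-trans M≤ (≤-reflexive (trans (sym (+-suc j k)) (cong (j +_) (+-comm 1 k)))))

        along : ∀ {z v} → y ⊢ z ∼ _ → E y z → Desc z v → Deep u v → Desc _ v → Desc _ v′
        along ε e z→v deep = hom e z→v deep (_ , s′) deep′ ex
        -- A deep vertex `w′` below the common descendant `w` of two linked children takes over the
        -- role of `v`.
        along ((_ , e₂ , w , z→w , z₂→w) ◅ chain) e z→v deep x→v with extend M w
        ... | w′ , t = along chain e₂ (Desc-trans z₂→w (_ , t)) deep-w′
            (hom e z→v deep (Desc-trans z→w (_ , t)) deep-w′ ex x→v)
          where deep-w′ = deepen (_ , r ++ʷ (e ∺ proj₂ z→w)) t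

    impossible : ⊥
    impossible with ∣p*p⇒≤p⊎≡p*p pr (classSize∣q e₀)
    ... | inj₁ c≤p = not-homogeneous (homogeneous-small c≤p)
    ... | inj₂ c≡q = not-homogeneous λ e → homogeneous-walk c≡q M (e ∺ nil) (m≤m+n M 1)

  -- The descendant subdigraph is a tree

  disjoint-children : ∀ {u z z′ v} → E u z → E u z′ → Desc z v → Desc z′ v → z ≡ z′
  disjoint-children {z = z} {z′} e e′ r r′ with lem (z ≡ z′)
  ... | yes z≡z′ = z≡z′
  ... | no z≢z′  = ⊥-elim (Collision.impossible e e′ r r′ z≢z′)

  -- The first vertices of the two walks are children of `u` above `y`, hence equal; recurse below
  -- them.
  parent-unique : ∀ {n u x x′ y} → Walk n u x → Walk n u x′ → E x y → E x′ y → x ≡ x′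
  parent-unique nil     nil       _ _ = refl
  parent-unique (e ∺ r) (e′ ∺ r′) f f′
    with disjoint-children e e′ (Desc-trans (_ , r) (_ , f ∺ nil)) (Desc-trans (_ , r′) (_ , f′ ∺ nil))
  ... | refl = parent-unique r r′ f f′

  -- A directed edge raises the level by exactly one, so it cannot run from `y` to `x` when `m ≤ n`.
  uedge-down : ∀ {m n u x y} → Walk m u x → Walk n u y → m ≤ n → UEdge D x y → E x y × m + 1 ≡ n
  uedge-down r s m≤n (inj₁ e) = e , layered (r ++ʷ (e ∺ nil)) s
  uedge-down {m} {n} r s m≤n (inj₂ e) with layered (s ++ʷ (e ∺ nil)) r
  ... | refl = contradiction m≤n (<⇒≱ (m<m+n n (s≤s z≤n)))

  Desc⇒desc : ∀ {u v} → Desc u v → desc D u v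
  Desc⇒desc (n , r) = n , walk⇒arc r

  module _ (α : V) where

    usteps : ∀ {n x v} → Desc α x → Walk n x v → Star (UStep (desc D α)) x v
    usteps a nil     = ε
    usteps a (e ∺ r) = (Desc⇒desc a , Desc⇒desc b , inj₁ e) ◅ usteps b r
      where b = Desc-trans a (_ , e ∺ nil)

    -- The two neighbours on the cycle of a vertex of maximal level would be distinct parents of it.
    acyclic-desc : ¬ UCycleIn D (desc D α)
    acyclic-desc C = at-top (toℕ top) (toℕ<n top) refl
      where
      open UCycleIn C

      walk : ∀ i → Desc α (w (toℕ i))
      walk i with inP (toℕ i) (toℕ<n i)
      ... | s , a = s , arc⇒walk a

      level : Fin n → ℕ
      level = proj₁ ∘ walk

      top : Fin n
      -- The default for `argmax` is position 0.
      top = argmax level (fromℕ< (≤-trans (s≤s z≤n) three)) (allFin n)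

      walk-below : ∀ j → j < n → ∃ λ m → Walk m α (w j) × m ≤ level top
      walk-below j j<n = subst (λ j → ∃ λ m → Walk m α (w j) × m ≤ level top) (toℕ-fromℕ< j<n)
        (_ , proj₂ (walk i) , All.lookup (f[xs]≤f[argmax] {f = level} _ (allFin n)) (∈-allFin i))
        where i = fromℕ< j<n

      neighbours : ∀ {i j} → i < n → j < n →
        UEdge D (w i) (w (toℕ top)) → UEdge D (w j) (w (toℕ top)) → i ≡ j
      neighbours {i} {j} i<n j<n e e′ with walk-below i i<n | walk-below j j<n
      ... | m , r , m≤ | m′ , r′ , m′≤
        with uedge-down r (proj₂ (walk top)) m≤ e | uedge-down r′ (proj₂ (walk top)) m′≤ e′
      ...   | f , eq | f′ , eq′ with +-cancelʳ-≡ 1 m m′ (trans eq (sym eq′))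
      ...     | refl = inj i j i<n j<n (parent-unique r r′ f f′)

      at : ∀ {x k} → toℕ top ≡ k → UEdge D x (w k) → UEdge D x (w (toℕ top))
      at {x} eq = subst (UEdge D x ∘ w) (sym eq)

      at-top : ∀ k → k < n → toℕ top ≡ k → ⊥
      -- Position 0 has neighbours 1 and `n ∸ 1`, distinct because `3 ≤ n`.
      at-top zero _ eq = <⇒≢ 1<n∸1 (neighbours (≤-trans (s≤s (s≤s z≤n)) three) (≤-reflexive suc[n∸1])
          (at eq (swap (adj 0 (≤-trans (s≤s z≤n) three))))
          (at eq (subst (UEdge D (w (n ∸ 1))) (trans (cong w suc[n∸1]) closed)
            (adj (n ∸ 1) (≤-reflexive suc[n∸1])))))
        where
        1<n∸1 : 1 < n ∸ 1
        1<n∸1 = ∸-monoˡ-≤ 1 three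
        suc[n∸1] : suc (n ∸ 1) ≡ n
        suc[n∸1] = m+[n∸m]≡n (≤-trans (s≤s z≤n) three)
      at-top (suc k) k<n eq with suc (suc k) <? n
      ... | yes 2+k<n = <⇒≢ (m≤n+m (suc k) 1) (neighbours (<⇒≤ k<n) 2+k<n
          (at eq (adj k (<⇒≤ k<n)))
          (at eq (swap (adj (suc k) k<n))))
      -- At the last position the next vertex is position 0, and `3 ≤ n` makes `k` positive.
      ... | no 2+k≮n = <⇒≢ (≤-pred (≤-pred (≤-trans three (≮⇒≥ 2+k≮n)))) (sym
          (neighbours (<⇒≤ k<n) (≤-trans (s≤s z≤n) three)
          (at eq (adj k (<⇒≤ k<n)))
          (at eq (subst (λ x → UEdge D x (w (suc k))) (trans (cong w (≤-antisym k<n (≮⇒≥ 2+k≮n))) closed)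
            (swap (adj (suc k) k<n))))))

    tree : IsTreeOn D (desc D α)
    tree = connected , acyclic-desc
      where
      connected : ∀ u v → desc D α u → desc D α v → UWalkIn D (desc D α) u v
      connected u v a@(_ , r) (_ , s) = usteps⇒uwalk a
        -- The walk goes up from `u` to `α` and then down to `v`.
        (reverse ustep-sym (usteps (0 , nil) (arc⇒walk r)) ◅◅ usteps (0 , nil) (arc⇒walk s))

theorem1p1 : (D : Digraph) → Infinite D → Connected D → Primitive D →
    DistanceTransitive D → NoDirectedCycle D →
    (p : ℕ) → Prime p → (∀ α → OutValency D α (p * p)) →
    ∀ α → IsTreeOn D (desc D α)
theorem1p1 D _ _ prim transitive acyclic p pr valency α =
  Descendants.tree D (Walks.primitive⇒lem D α≢child prim) prim transitive acyclic pr valency α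
  where
  open Digraph D
  instance _ = prime⇒nonZero pr
  i : Fin (p * p)
  i = fromℕ< (>-nonZero⁻¹ (p * p) {{m*n≢0 p p}})
  -- Excluded middle is extracted from primitivity with this pair of distinct vertices.
  α≢child : α ≢ proj₁ (valency α) i
  α≢child eq = loopless α (subst (E α) (sym eq) (proj₁ (proj₂ (proj₂ (valency α))) i))
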